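{- Let $U$ be a set with a total order $\preceq$, let $k>1$, and let $\mathcal P$ be a $k$-pattern in $U$ that admits at most one reconstruction from $\preceq$-consecutive points. If $n$ is a positive integer and $r$ is the remainder when $n$ is divided by $k-1$, then \[ S_{\mathcal P}(n)\le \frac{(n-r)(n+r-k+1)}{2k-2}. \]
   Context: A pattern in $U$ is a collection $\mathcal P$ of finite subsets of $U$ (its instances; in the paper, an equivalence class of subsets under some equivalence relation); it is a $k$-pattern if every instance has exactly $k$ elements. For finite $V\subseteq U$, $S_{\mathcal P}(V)=|\{P\subseteq V: P\in\mathcal P\}|$, and $S_{\mathcal P}(n)=\max\{S_{\mathcal P}(V):V\subseteq U,\ |V|=n\}$. The $i$th point of a finite set with respect to $\preceq$ is the element having exactly $i-1$ elements of the set $\preceq$-below it. Given $j\in\{1,\dots,k-1\}$ and $u\prec v$ in $U$, a reconstruction of $\mathcal P$ with $u,v$ as $j$th and $(j+1)$th points is an instance $P\in\mathcal P$ whose $j$th and $(j+1)$th points are $u$ and $v$ respectively. $\mathcal P$ admits at most one reconstruction from $\preceq$-consecutive points if for every $j\in\{1,\dots,k-1\}$ and every $u\prec v$ in $U$ there is at most one such reconstruction. -}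

module Defs where

open import Level using (Level; _⊔_) renaming (suc to lsuc)
open import Data.List.Base using (List; length)
import Data.List.Membership.Setoid as SetoidMembership
open import Data.List.Membership.Propositional using (_∈_)
open import Data.List.Relation.Binary.Subset.Propositional using (_⊆_)
import Data.List.Relation.Unary.Unique.Setoid as SetoidUnique
open import Data.List.Relation.Unary.Unique.Propositional using (Unique)
open import Data.Nat.Base using (ℕ; suc; _∸_; _*_; _≤_; _<_; NonZero; >-nonZero)
open import Data.Nat.Properties using (m<n⇒0<n∸m; *-monoʳ-<)
open import Data.Product.Base using (_×_; _,_; ∃-syntax)
open import Function.Base using (id; _∘_)
open import Function.Bundles using (_⇔_)
open import Relation.Binary.Bundles using (Setoid)
open import Relation.Binary.Construct.NonStrictToStrict using () renaming (_<_ to Strict)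
open import Relation.Binary.Core using (Rel)
open import Relation.Binary.PropositionalEquality using (_≡_; setoid)
open import Relation.Unary using (Pred)

private
  variable
    a ℓ p : Level

-- Sizes are given by a relation rather than a function because the
-- predicates being counted are not assumed decidable.
HasCardinality : (S : Setoid a ℓ) → Pred (Setoid.Carrier S) p → ℕ → Set (a ⊔ ℓ ⊔ p)
HasCardinality S X m =
  ∃[ xs ] SetoidUnique.Unique S xs × length xs ≡ m
        × (∀ x → X x ⇔ SetoidMembership._∈_ S x xs)

-- Two repetition-free lists represent the same finite subset when they have
-- the same members, that is, when they are related by _≐_ below.
record FiniteSubset (U : Set a) : Set a where
  constructor finiteSubset
  field
    elements : List U
    distinct : Unique elements

open FiniteSubset public

module _ {U : Set a} where

  infix 4 _∈ˢ_ _⊆ˢ_ _≐_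

  ∣_∣ : FiniteSubset U → ℕ
  ∣ V ∣ = length (elements V)

  _∈ˢ_ : U → FiniteSubset U → Set a
  u ∈ˢ V = u ∈ elements V

  _⊆ˢ_ : Rel (FiniteSubset U) a
  V ⊆ˢ W = elements V ⊆ elements W

  _≐_ : Rel (FiniteSubset U) a
  V ≐ W = V ⊆ˢ W × W ⊆ˢ V

subsetSetoid : Set a → Setoid a a
subsetSetoid U = record
  { Carrier       = FiniteSubset U
  ; _≈_           = _≐_
  ; isEquivalence = record
    { refl  = id , id
    ; sym   = λ (f , g) → g , f
    ; trans = λ (f , g) (h , k) → h ∘ f , g ∘ k
    }
  }

record Pattern (U : Set a) (p : Level) : Set (a ⊔ lsuc p) where
  field
    IsInstance : FiniteSubset U → Set p
    respects   : ∀ {P Q} → P ≐ Q → IsInstance P → IsInstance Q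

open Pattern public

module _ {U : Set a} where

  IsKPattern : ℕ → Pattern U p → Set (a ⊔ p)
  IsKPattern k 𝒫 = ∀ P → IsInstance 𝒫 P → ∣ P ∣ ≡ k

  -- S_𝒫(V) = m
  SubsetCount : Pattern U p → FiniteSubset U → ℕ → Set (a ⊔ p)
  SubsetCount 𝒫 V = HasCardinality (subsetSetoid U) (λ P → P ⊆ˢ V × IsInstance 𝒫 P)

  -- S_𝒫(n) = m.  No such m exists when U has fewer than n elements, the
  -- maximum being then over the empty family.  Otherwise such an m exists up to
  -- double negation, so bounding every such m by a number b also bounds every
  -- value of S_𝒫(V) with ∣ V ∣ ≡ n by b.
  MaxCount : Pattern U p → ℕ → ℕ → Set (a ⊔ p)
  MaxCount 𝒫 n m =
      (∃[ V ] ∣ V ∣ ≡ n × SubsetCount 𝒫 V m)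
    × (∀ V s → ∣ V ∣ ≡ n → SubsetCount 𝒫 V s → s ≤ m)

module _ {U : Set a} (_≼_ : Rel U ℓ) where

  private
    infix 4 _≺_
    _≺_ : Rel U (a ⊔ ℓ)
    _≺_ = Strict _≡_ _≼_

  -- Positions start at 1; i = 0 is never used.
  IsPoint : FiniteSubset U → ℕ → U → Set (a ⊔ ℓ)
  IsPoint V i u = u ∈ˢ V × HasCardinality (setoid U) (λ x → x ∈ˢ V × x ≺ u) (i ∸ 1)

  IsReconstruction : Pattern U p → ℕ → U → U → FiniteSubset U → Set (a ⊔ ℓ ⊔ p)
  IsReconstruction 𝒫 j u v P = IsInstance 𝒫 P × IsPoint P j u × IsPoint P (suc j) v

  AtMostOneReconstruction : ℕ → Pattern U p → Set (a ⊔ ℓ ⊔ p)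
  AtMostOneReconstruction k 𝒫 =
    ∀ j → 1 ≤ j → j ≤ k ∸ 1 → ∀ u v → u ≺ v →
    ∀ P Q → IsReconstruction 𝒫 j u v P → IsReconstruction 𝒫 j u v Q → P ≐ Q

k∸1-nonZero : ∀ {k} → 1 < k → NonZero (k ∸ 1)
k∸1-nonZero 1<k = >-nonZero (m<n⇒0<n∸m 1<k)

2k∸2-nonZero : ∀ {k} → 1 < k → NonZero (2 * k ∸ 2)
2k∸2-nonZero 1<k = >-nonZero (m<n⇒0<n∸m (*-monoʳ-< 2 1<k))

{-# OPTIONS --safe #-}
-- Put V in increasing order and cut it into k - 1 consecutive blocks of sizes as
-- equal as possible.  For an instance P ⊆ V take the least j such that the
-- (j+1)th point v of P lies in the first j blocks; the kth point shows that
-- j ≤ k - 1.  By minimality the jth point u lies beyond the first j - 1 blocks, so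
-- u and v both lie in the jth block.  As P is determined by j, u and v, there are
-- at most as many instances as pairs inside the blocks.  With n = q (k - 1) + r
-- there are r blocks of size q + 1 and k - 1 - r of size q, and the number of
-- these pairs is the claimed bound.
module Submission where

open import Defs
open import Level using (Level)
open import Data.Nat.Base using (ℕ; _∸_; _*_; _<_; _%_)
open import Data.Integer.Base as ℤ using (ℤ; +_)
open import Data.Rational.Base as ℚ using (ℚ)
open import Relation.Binary.Core using (Rel)
open import Relation.Binary.Structures using (IsTotalOrder)
open import Relation.Binary.PropositionalEquality using (_≡_)

open import Data.Fin.Base using (zero; suc)
open import Data.Fin.Properties using (injective⇒≤)
import Data.Integer.Properties as ℤ
import Data.Integer.Tactic.RingSolver as ℤ-Solver
open import Data.List.Base
  using (List; []; _∷_; _++_; concat; drop; length; lookup; map; replicate; take)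
open import Data.List.Membership.Propositional using (_∈_)
open import Data.List.Membership.Propositional.Properties
  using (∈-++⁻; ∈-++⁺ˡ; ∈-++⁺ʳ; ∈-lookup; ∈-map⁺)
import Data.List.Membership.Setoid.Properties as SetoidMembership
open import Data.List.Properties
  using ( ++-assoc; length-++; length-drop; length-map; length-replicate; length-take; map-++
        ; map-replicate; take++drop≡id)
open import Data.List.Relation.Binary.Permutation.Propositional
  using (_↭_; prep; swap; ↭-refl; ↭-sym; ↭-trans)
open import Data.List.Relation.Binary.Permutation.Propositional.Properties
  using (All-resp-↭; ∈-resp-↭; ↭-length)
open import Data.List.Relation.Binary.Subset.Propositional using (_⊆_)
open import Data.List.Relation.Unary.All as All using (All; []; _∷_)
open import Data.List.Relation.Unary.AllPairs as AllPairs using (AllPairs; []; _∷_)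
open import Data.List.Relation.Unary.Any using (here; there; index)
open import Data.List.Relation.Unary.Unique.Propositional using (Unique)
import Data.List.Relation.Unary.Unique.Setoid as SetoidUnique
open import Data.Nat.Base using (NonZero; zero; suc; _+_; _≤_; _/_; z≤n; s≤s; s≤s⁻¹)
open import Data.Nat.DivMod using (m≡m%n+[m/n]*n; m%n<n)
open import Data.Nat.ListAction using (sum)
open import Data.Nat.ListAction.Properties using (sum-++)
open import Data.Nat.Properties
  using ( *-monoʳ-≤; +-comm; +-monoˡ-≤; m+[n∸m]≡n; m+n∸m≡n; m≤m+n; m≤n⇒m⊓n≡m; <⇒≤; ≤-reflexive
        ; module ≤-Reasoning)
open import Data.Nat.Tactic.RingSolver using (solve-∀)
open import Data.Product.Base using (_×_; _,_; ∃-syntax; map₁; proj₁; proj₂)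
import Data.Rational.Properties as ℚ
import Data.Rational.Unnormalised.Base as ℚᵘ
import Data.Rational.Unnormalised.Properties as ℚᵘ
open import Data.Sum.Base using (_⊎_; inj₁; inj₂)
open import Function.Base using (_∘_)
open import Function.Bundles using (mk⇔; module Equivalence)
open import Relation.Binary.Bundles using (Setoid)
open import Relation.Binary.Construct.NonStrictToStrict using (<-asym; <-trans)
  renaming (_<_ to Strict)
open import Relation.Binary.PropositionalEquality
  using (refl; setoid; sym; trans; cong; cong₂; subst; subst₂; _≢_; module ≡-Reasoning)
open import Relation.Nullary.Negation using (¬_; contradiction)

private
  variable
    a b ℓ ℓ′ p : Level
    A : Set a
    B : Set b

-- Lists and counting by injections.

module _ {R : Rel A ℓ′} where

  AllPairs-++⁻ : ∀ xs {ys} → AllPairs R (xs ++ ys) →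
                 AllPairs R xs × AllPairs R ys × (∀ {x y} → x ∈ xs → y ∈ ys → R x y)
  AllPairs-++⁻ []       Rys        = [] , Rys , λ ()
  AllPairs-++⁻ (x ∷ xs) (Rx ∷ Rxs) with AllPairs-++⁻ xs Rxs
  ... | Rxs′ , Rys , cross =
    All.tabulate (All.lookup Rx ∘ ∈-++⁺ˡ) ∷ Rxs′ , Rys , λ where
      (here refl) y∈ys → All.lookup Rx (∈-++⁺ʳ xs y∈ys)
      (there x∈xs) → cross x∈xs

module _ (S : Setoid a ℓ) where

  open Setoid S using (Carrier; _≈_) renaming (sym to ≈-sym)

  lookup-injective : ∀ {xs} → SetoidUnique.Unique S xs →
                     ∀ i j → lookup xs i ≈ lookup xs j → i ≡ j
  lookup-injective (_ ∷ _)    zero    zero    _  = refl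
  lookup-injective (x∉ ∷ _)   zero    (suc j) eq = contradiction eq (All.lookup x∉ (∈-lookup j))
  lookup-injective (x∉ ∷ _)   (suc i) zero    eq = contradiction (≈-sym eq) (All.lookup x∉ (∈-lookup i))
  lookup-injective (_ ∷ uniq) (suc i) (suc j) eq = cong suc (lookup-injective uniq i j eq)

  -- The injection is a relation because the chosen `y` may depend on the representative of `x`;
  -- only the way back, from `y` to `x` up to `≈`, has to be determined. Positions in the
  -- enumeration of `X` then inject into positions in `ys`.
  HasCardinality-≤ : ∀ {X : Carrier → Set p} {R : Carrier → B → Set ℓ′} {m} →
    HasCardinality S X m → (ys : List B) →
    (∀ x → X x → ∃[ y ] y ∈ ys × R x y) →
    (∀ {x x′ y} → R x y → R x′ y → x ≈ x′) →
    m ≤ length ys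
  HasCardinality-≤ {X = X} {R} (xs , uniq , refl , X⇔∈) ys image R-inj =
    injective⇒≤ {f = λ i → index (y∈ys i)} λ {i} {j} eq →
      lookup-injective uniq i j
        (R-inj (related i) (subst (R _) (sym (SetoidMembership.index-injective (setoid _)
          (y∈ys i) (y∈ys j) eq)) (related j)))
    where
    image′ : ∀ i → ∃[ y ] y ∈ ys × R (lookup xs i) y
    image′ i = image (lookup xs i) (Equivalence.from (X⇔∈ _) (SetoidMembership.∈-lookup S xs i))
    y∈ys : ∀ i → proj₁ (image′ i) ∈ ys
    y∈ys i = proj₁ (proj₂ (image′ i))
    related : ∀ i → R (lookup xs i) (proj₁ (image′ i))
    related i = proj₂ (proj₂ (image′ i))

-- Pairs inside blocks and their number.

pairs : List A → List (A × A)
pairs []       = []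
pairs (x ∷ xs) = map (x ,_) xs ++ pairs xs

-- The binomial coefficient l(l - 1)/2, in a form free of division and truncated subtraction.
length-pairs : ∀ (xs : List A) → 2 * length (pairs xs) + length xs ≡ length xs * length xs
length-pairs []       = refl
length-pairs (x ∷ xs) = begin
  2 * length (map (x ,_) xs ++ pairs xs) + suc l      ≡⟨ cong (λ m → 2 * m + suc l) (length-++ (map (x ,_) xs)) ⟩
  2 * (length (map (x ,_) xs) + t) + suc l            ≡⟨ cong (λ m → 2 * (m + t) + suc l) (length-map (x ,_) xs) ⟩
  2 * (l + t) + suc l                                 ≡⟨ rearrange l t ⟩
  (2 * t + l) + (2 * l + 1)                           ≡⟨ cong (λ t → t + (2 * l + 1)) (length-pairs xs) ⟩
  l * l + (2 * l + 1)                                 ≡⟨ square l ⟩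
  suc l * suc l                                       ∎
  where
  open ≡-Reasoning
  l = length xs
  t = length (pairs xs)
  rearrange : ∀ l t → 2 * (l + t) + suc l ≡ (2 * t + l) + (2 * l + 1)
  rearrange = solve-∀
  square : ∀ l → l * l + (2 * l + 1) ≡ suc l * suc l
  square = solve-∀

-- The tag i counts the blocks from 0, whereas positions in an instance start at 1:
-- a pair tagged i is to hold the points at positions j = i + 1 and j + 1.
blockPairs : List (List A) → List (ℕ × A × A)
blockPairs []         = []
blockPairs (xs ∷ xss) = map (0 ,_) (pairs xs) ++ map (map₁ suc) (blockPairs xss)

-- `length-pairs` added up over the blocks; tagging changes no lengths.
length-blockPairs : ∀ {A : Set a} (xss : List (List A)) →
  2 * length (blockPairs xss) + sum (map length xss) ≡ sum (map (λ c → c * c) (map length xss))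
length-blockPairs         []         = refl
length-blockPairs {A = A} (xs ∷ xss) = begin
  2 * length (blockPairs (xs ∷ xss)) + (l + s)  ≡⟨ cong (λ m → 2 * m + (l + s)) split ⟩
  2 * (t + u) + (l + s)                         ≡⟨ rearrange t u l s ⟩
  (2 * t + l) + (2 * u + s)                     ≡⟨ cong₂ _+_ (length-pairs xs) (length-blockPairs xss) ⟩
  l * l + sum (map (λ c → c * c) (map length xss)) ∎
  where
  open ≡-Reasoning
  l = length xs
  s = sum (map length xss)
  t = length (pairs xs)
  u = length (blockPairs xss)
  split : length (blockPairs (xs ∷ xss)) ≡ t + u
  split = trans (length-++ (map tag (pairs xs)))
    (cong₂ _+_ (length-map tag (pairs xs)) (length-map {B = ℕ × A × A} (map₁ suc) (blockPairs xss)))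
    where
    tag : A × A → ℕ × A × A
    tag = 0 ,_
  rearrange : ∀ t u l s → 2 * (t + u) + (l + s) ≡ (2 * t + l) + (2 * u + s)
  rearrange = solve-∀

-- Cutting a list into blocks of prescribed sizes.

cut : ∀ (cs : List ℕ) (xs : List A) → sum cs ≡ length xs →
      ∃[ xss ] concat xss ≡ xs × map length xss ≡ cs
cut []       []  _  = [] , refl , refl
cut (c ∷ cs) xs  eq with cut cs (drop c xs) (sym (begin
    length (drop c xs)   ≡⟨ length-drop c xs ⟩
    length xs ∸ c        ≡⟨ cong (_∸ c) eq ⟨
    (c + sum cs) ∸ c     ≡⟨ m+n∸m≡n c (sum cs) ⟩
    sum cs               ∎))
  where open ≡-Reasoning
... | xss , concat≡ , lengths≡ =
    take c xs ∷ xss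
  , trans (cong (take c xs ++_) concat≡) (take++drop≡id c xs)
  -- As a summand of the total length, `c` is at most `length xs`, so `take` does not fall short.
  , cong₂ _∷_ (trans (length-take c xs) (m≤n⇒m⊓n≡m (subst (c ≤_) eq (m≤m+n c (sum cs))))) lengths≡

sum-replicate : ∀ m x → sum (replicate m x) ≡ m * x
sum-replicate zero    x = refl
sum-replicate (suc m) x = cong (λ t → x + t) (sum-replicate m x)

sum-two-sizes : ∀ m x m′ y → sum (replicate m x ++ replicate m′ y) ≡ m * x + m′ * y
sum-two-sizes m x m′ y = trans (sum-++ (replicate m x) (replicate m′ y))
  (cong₂ _+_ (sum-replicate m x) (sum-replicate m′ y))

map-two-sizes : ∀ (f : ℕ → ℕ) m x m′ y →
  map f (replicate m x ++ replicate m′ y) ≡ replicate m (f x) ++ replicate m′ (f y)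
map-two-sizes f m x m′ y = trans (map-++ f (replicate m x) (replicate m′ y))
  (cong₂ _++_ (map-replicate f m x) (map-replicate f m′ y))

-- `ℚ./` reduces to lowest terms, so the comparison is made on unnormalised fractions, where `≤` is
-- cross-multiplication.
/1-≤-/ : ∀ m i d .{{_ : NonZero d}} → (+ m) ℤ.* (+ d) ℤ.≤ i → (+ m) ℚ./ 1 ℚ.≤ i ℚ./ d
/1-≤-/ m i (suc d) md≤i = ℚ.toℚᵘ-cancel-≤ (begin
  ℚ.toℚᵘ ((+ m) ℚ./ 1)    ≃⟨ ℚ.toℚᵘ-fromℚᵘ (ℚᵘ.mkℚᵘ (+ m) 0) ⟩
  ℚᵘ.mkℚᵘ (+ m) 0         ≤⟨ ℚᵘ.*≤* (subst ((+ m) ℤ.* (+ suc d) ℤ.≤_) (sym (ℤ.*-identityʳ i)) md≤i) ⟩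
  ℚᵘ.mkℚᵘ i d             ≃⟨ ℚ.toℚᵘ-fromℚᵘ (ℚᵘ.mkℚᵘ i d) ⟨
  ℚ.toℚᵘ (i ℚ./ suc d)    ∎)
  where open ℚᵘ.≤-Reasoning

-- Increasing lists and positions in a total order.

module _ {U : Set a} {_≼_ : Rel U ℓ} (isTotalOrder : IsTotalOrder _≡_ _≼_) where

  open IsTotalOrder isTotalOrder using (total; antisym; isPartialOrder)

  private
    infix 4 _≺_
    _≺_ : Rel U _
    _≺_ = Strict _≡_ _≼_

    ≺-asym : ∀ {x y} → x ≺ y → ¬ y ≺ x
    ≺-asym = <-asym _≡_ _≼_ antisym

    ≺-trans : ∀ {x y z} → x ≺ y → y ≺ z → x ≺ z
    ≺-trans = <-trans _≡_ _≼_ isPartialOrder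

  -- As `x` differs from every entry, each comparison supplied by `total` is already strict.
  insert : ∀ x {ys} → All (x ≢_) ys → AllPairs _≺_ ys → ∃[ zs ] zs ↭ x ∷ ys × AllPairs _≺_ zs
  insert x [] [] = x ∷ [] , ↭-refl , [] ∷ []
  insert x {y ∷ ys} (x≢y ∷ x∉ys) (y≺ys ∷ ys↗) with total x y
  ... | inj₁ x≼y = x ∷ y ∷ ys , ↭-refl , (x≺y ∷ All.map (≺-trans x≺y) y≺ys) ∷ y≺ys ∷ ys↗
    where x≺y = x≼y , x≢y
  ... | inj₂ y≼x with insert x x∉ys ys↗
  ...   | zs , zs↭ , zs↗ =
    y ∷ zs , ↭-trans (prep y zs↭) (swap y x ↭-refl) ,
    All-resp-↭ (↭-sym zs↭) ((y≼x , x≢y ∘ sym) ∷ y≺ys) ∷ zs↗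

  sort : ∀ {xs} → Unique xs → ∃[ ys ] ys ↭ xs × AllPairs _≺_ ys
  sort []                  = [] , ↭-refl , []
  sort {x ∷ _} (x∉xs ∷ uniq) with sort uniq
  ... | ys , ys↭xs , ys↗ with insert x (All-resp-↭ (↭-sym ys↭xs) x∉xs) ys↗
  ...   | zs , zs↭ , zs↗ = zs , ↭-trans zs↭ (prep x ys↭xs) , zs↗

  -- `pairs` puts the earlier entry first, which in an increasing list is the smaller one.
  ∈-pairs : ∀ {xs u v} → AllPairs _≺_ xs → u ∈ xs → v ∈ xs → u ≺ v → (u , v) ∈ pairs xs
  ∈-pairs _           (here refl)  (here refl)  u≺v = contradiction refl (proj₂ u≺v)
  ∈-pairs _           (here refl)  (there v∈xs) _   = ∈-++⁺ˡ (∈-map⁺ (_ ,_) v∈xs)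
  ∈-pairs (x≺xs ∷ _)  (there u∈xs) (here refl)  u≺v = contradiction u≺v (≺-asym (All.lookup x≺xs u∈xs))
  ∈-pairs {x ∷ xs} (_ ∷ xs↗) (there u∈xs) (there v∈xs) u≺v =
    ∈-++⁺ʳ (map (x ,_) xs) (∈-pairs xs↗ u∈xs v∈xs u≺v)

  -- Induction that drops the first point and the first block together, so that `length pre` and the
  -- tag grow in step. If `p′` is in the first block, so is the smaller `p`. Otherwise `p′` and all
  -- later points lie in the remaining blocks, and the length hypothesis survives the removal.
  consecutive-in-block : ∀ xss {ps} → AllPairs _≺_ (concat xss) → AllPairs _≺_ ps →
    ps ⊆ concat xss → length xss < length ps →
    ∃[ pre ] ∃[ u ] ∃[ v ] ∃[ post ]
      ps ≡ pre ++ u ∷ v ∷ post × (length pre , u , v) ∈ blockPairs xss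
  consecutive-in-block [] {p ∷ ps} _ _ ps⊆ _ = contradiction (ps⊆ (here refl)) λ ()
  consecutive-in-block (xs ∷ xss) {p ∷ []} _ _ _ (s≤s ())
  consecutive-in-block (xs ∷ xss) {p ∷ p′ ∷ ps} xss↗ ((p≺p′ ∷ _) ∷ ps↗@(p′≺ps ∷ _)) ps⊆ (s≤s len)
    with AllPairs-++⁻ xs xss↗
  ... | xs↗ , rest↗ , xs≺rest with ∈-++⁻ xs (ps⊆ (there (here refl)))
  ...   | inj₁ p′∈xs = [] , p , p′ , ps , refl ,
    ∈-++⁺ˡ (∈-map⁺ (0 ,_) (∈-pairs xs↗ p∈xs p′∈xs p≺p′))
    where
    p∈xs : p ∈ xs
    p∈xs with ∈-++⁻ xs (ps⊆ (here refl))
    ... | inj₁ p∈xs   = p∈xs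
    ... | inj₂ p∈rest = contradiction p≺p′ (≺-asym (xs≺rest p′∈xs p∈rest))
  ...   | inj₂ p′∈rest with consecutive-in-block xss rest↗ ps↗ ps⊆rest len
    where
    ps⊆rest : p′ ∷ ps ⊆ concat xss
    ps⊆rest (here refl) = p′∈rest
    ps⊆rest (there z∈ps) with ∈-++⁻ xs (ps⊆ (there (there z∈ps)))
    ... | inj₁ z∈xs   = contradiction (All.lookup p′≺ps z∈ps) (≺-asym (xs≺rest z∈xs p′∈rest))
    ... | inj₂ z∈rest = z∈rest
  ...     | pre , u , v , post , ps≡ , ∈blockPairs =
    p ∷ pre , u , v , post , cong (p ∷_) ps≡ ,
    ∈-++⁺ʳ (map (0 ,_) (pairs xs)) (∈-map⁺ (map₁ suc) ∈blockPairs)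

  -- In an increasing enumeration the points below `u` are exactly those of `pre`, so `pre` itself
  -- is the list required by `HasCardinality`.
  isPoint : ∀ P pre {u post} → AllPairs _≺_ (pre ++ u ∷ post) → pre ++ u ∷ post ↭ elements P →
            IsPoint _≼_ P (suc (length pre)) u
  isPoint P pre {u} {post} ps↗ ps↭P with AllPairs-++⁻ pre ps↗
  ... | pre↗ , u≺post ∷ _ , pre≺rest =
    ∈-resp-↭ ps↭P (∈-++⁺ʳ pre (here refl)) ,
    pre , AllPairs.map proj₂ pre↗ , refl , λ x → mk⇔
      (λ (x∈P , x≺u) → below x≺u (∈-++⁻ pre (∈-resp-↭ (↭-sym ps↭P) x∈P)))
      (λ x∈pre → ∈-resp-↭ ps↭P (∈-++⁺ˡ x∈pre) , pre≺rest x∈pre (here refl))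
    where
    below : ∀ {x} → x ≺ u → x ∈ pre ⊎ x ∈ u ∷ post → x ∈ pre
    below x≺u (inj₁ x∈pre)                  = x∈pre
    below x≺u (inj₂ (here refl))            = contradiction refl (proj₂ x≺u)
    below x≺u (inj₂ (there x∈post)) = contradiction x≺u (≺-asym (All.lookup u≺post x∈post))

  -- Counting the instances inside a finite set.

  module _ {K} {𝒫 : Pattern U p} (𝒫-k : IsKPattern (suc K) 𝒫)
           (unique : AtMostOneReconstruction _≼_ (suc K) 𝒫) where

    -- There is one more point than there are blocks, as `consecutive-in-block` demands. The two
    -- inequalities are carried along because `unique` asks for them.
    reconstruct : ∀ xss → length xss ≡ K → AllPairs _≺_ (concat xss) →
      ∀ P → IsInstance 𝒫 P → elements P ⊆ concat xss →
      ∃[ t ] t ∈ blockPairs xss ×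
        (let i , u , v = t in suc i ≤ K × u ≺ v × IsReconstruction _≼_ 𝒫 (suc i) u v P)
    reconstruct xss refl xss↗ P P∈𝒫 P⊆ with sort (distinct P)
    ... | ps , ps↭P , ps↗
      with consecutive-in-block xss xss↗ ps↗ (P⊆ ∘ ∈-resp-↭ ps↭P)
             (≤-reflexive (sym (trans (↭-length ps↭P) (𝒫-k P P∈𝒫))))
    ... | pre , u , v , post , refl , t∈ =
      (length pre , u , v) , t∈ , index≤K , u≺v , P∈𝒫 , isPoint P pre ps↗ ps↭P ,
      -- The points before `v` are those of `pre ++ u ∷ []`, hence its position is two more than
      -- `length pre`.
      subst (λ j → IsPoint _≼_ P j v) (cong suc length-pre∷ʳu)
        (isPoint P (pre ++ u ∷ []) (subst (AllPairs _≺_) ps≡ ps↗) (subst (_↭ elements P) ps≡ ps↭P))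
      where
      length-pre∷ʳu : length (pre ++ u ∷ []) ≡ suc (length pre)
      length-pre∷ʳu = trans (length-++ pre) (+-comm (length pre) 1)
      ps≡ : pre ++ u ∷ v ∷ post ≡ (pre ++ u ∷ []) ++ v ∷ post
      ps≡ = sym (++-assoc pre (u ∷ []) (v ∷ post))
      u≺v : u ≺ v
      u≺v = All.lookup (AllPairs.head (proj₁ (proj₂ (AllPairs-++⁻ pre ps↗)))) (here refl)
      index≤K : suc (length pre) ≤ length xss
      index≤K = s≤s⁻¹ (begin
        2 + length pre                     ≤⟨ m≤m+n _ (length post) ⟩
        2 + length pre + length post       ≡⟨ rearrange (length pre) (length post) ⟩
        length pre + (2 + length post)     ≡⟨ length-++ pre ⟨
        length (pre ++ u ∷ v ∷ post)       ≡⟨ ↭-length ps↭P ⟩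
        ∣ P ∣                              ≡⟨ 𝒫-k P P∈𝒫 ⟩
        suc (length xss)                   ∎)
        where
        open ≤-Reasoning
        rearrange : ∀ m n → 2 + m + n ≡ m + (2 + n)
        rearrange = solve-∀

    SubsetCount-≤-blockPairs : ∀ xss → length xss ≡ K → AllPairs _≺_ (concat xss) →
      ∀ V {m} → concat xss ↭ elements V → SubsetCount 𝒫 V m → m ≤ length (blockPairs xss)
    SubsetCount-≤-blockPairs xss len xss↗ V xss↭V count =
      HasCardinality-≤ (subsetSetoid U) count (blockPairs xss)
        (λ P (P⊆V , P∈𝒫) → reconstruct xss len xss↗ P P∈𝒫 (∈-resp-↭ (↭-sym xss↭V) ∘ P⊆V))
        -- Both instances carry the same triple, so the inequalities of the first serve for both;
        -- `s≤s z≤n` is 1 ≤ j for j = i + 1.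
        (λ (i≤K , u≺v , P-rec) (_ , _ , Q-rec) → unique _ (s≤s z≤n) i≤K _ _ u≺v _ _ P-rec Q-rec)

    -- There are `s` blocks of size q + 1 and `d` of size q. The total size stays on the left, as in
    -- `length-blockPairs`, to avoid truncated subtraction.
    SubsetCount-≤ : ∀ s d q → s + d ≡ K → ∀ V {m} → ∣ V ∣ ≡ s * suc q + d * q → SubsetCount 𝒫 V m →
      2 * m + (s * suc q + d * q) ≤ s * (suc q * suc q) + d * (q * q)
    SubsetCount-≤ s d q s+d≡K V {m} ∣V∣≡ count
      with sort (distinct V)
    ... | vs , vs↭V , vs↗
      with cut (replicate s (suc q) ++ replicate d q) vs
             (trans (sum-two-sizes s (suc q) d q) (sym (trans (↭-length vs↭V) ∣V∣≡)))
    ... | xss , refl , lengths≡ = begin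
      2 * m + n
        ≤⟨ +-monoˡ-≤ n (*-monoʳ-≤ 2 (SubsetCount-≤-blockPairs xss length≡K vs↗ V vs↭V count)) ⟩
      2 * length (blockPairs xss) + n
        ≡⟨ cong (λ t → 2 * length (blockPairs xss) + t) (trans (cong sum lengths≡) (sum-two-sizes s (suc q) d q)) ⟨
      2 * length (blockPairs xss) + sum (map length xss)
        ≡⟨ length-blockPairs xss ⟩
      sum (map (λ c → c * c) (map length xss))
        ≡⟨ cong (sum ∘ map (λ c → c * c)) lengths≡ ⟩
      sum (map (λ c → c * c) (replicate s (suc q) ++ replicate d q))
        ≡⟨ cong sum (map-two-sizes (λ c → c * c) s (suc q) d q) ⟩
      sum (replicate s (suc q * suc q) ++ replicate d (q * q))
        ≡⟨ sum-two-sizes s (suc q * suc q) d (q * q) ⟩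
      s * (suc q * suc q) + d * (q * q) ∎
      where
      open ≤-Reasoning
      n = s * suc q + d * q
      length≡K : length xss ≡ K
      length≡K = begin-equality
        length xss                                      ≡⟨ length-map length xss ⟨
        length (map length xss)                         ≡⟨ cong length lengths≡ ⟩
        length (replicate s (suc q) ++ replicate d q)   ≡⟨ length-++ (replicate s (suc q)) ⟩
        length (replicate s (suc q)) + length (replicate d q)
                                                        ≡⟨ cong₂ _+_ (length-replicate s) (length-replicate d) ⟩
        s + d                                           ≡⟨ s+d≡K ⟩
        K                                               ∎

-- Integer arithmetic and the final bound.

-- The hypothesis multiplied by K, since n = s (q + 1) + d q.
bound-scaled : ∀ s d q m → let K = s + d; n = s + q * K; k = suc K in
  2 * m + (s * suc q + d * q) ≤ s * (suc q * suc q) + d * (q * q) →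
  (+ m) ℤ.* (+ (2 * k ∸ 2)) ℤ.≤ ((+ n) ℤ.- (+ s)) ℤ.* ((+ n) ℤ.+ (+ s) ℤ.- (+ k) ℤ.+ (+ 1))
bound-scaled s d q m le = begin
  (+ m) ℤ.* (+ (2 * k ∸ 2))                      ≡⟨ ℤ.pos-* m (2 * k ∸ 2) ⟨
  -- With `2 * suc K` rewritten as `2 + 2 * K`, the truncated subtraction computes.
  + (m * (2 * k ∸ 2))                            ≡⟨ cong (λ t → + (m * (t ∸ 2))) (double K) ⟩
  + (m * (2 * K))                                ≡⟨ cong +_ (swap-factors m K) ⟩
  + (K * (2 * m))                                ≡⟨ ℤ.pos-* K (2 * m) ⟩
  (+ K) ℤ.* (+ (2 * m))                          ≤⟨ ℤ.*-monoˡ-≤-nonNeg (+ K) 2m≤ ⟩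
  (+ K) ℤ.* ((+ squares) ℤ.- (+ sizes))
    ≡⟨ cong₂ (λ t u → (+ K) ℤ.* (t ℤ.- u)) squares≡ sizes≡ ⟩
  (+ K) ℤ.* ((+ s ℤ.* ((+ 1 ℤ.+ + q) ℤ.* (+ 1 ℤ.+ + q)) ℤ.+ + d ℤ.* (+ q ℤ.* + q))
    ℤ.- (+ s ℤ.* (+ 1 ℤ.+ + q) ℤ.+ + d ℤ.* + q))
    ≡⟨ expand (+ s) (+ d) (+ q) ⟩
  (n′ ℤ.- (+ s)) ℤ.* (n′ ℤ.+ (+ s) ℤ.- (+ k) ℤ.+ (+ 1))
    ≡⟨ cong (λ t → (t ℤ.- (+ s)) ℤ.* (t ℤ.+ (+ s) ℤ.- (+ k) ℤ.+ (+ 1))) n≡ ⟨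
  ((+ n) ℤ.- (+ s)) ℤ.* ((+ n) ℤ.+ (+ s) ℤ.- (+ k) ℤ.+ (+ 1)) ∎
  where
  open ℤ.≤-Reasoning
  K = s + d
  k = suc K
  n = s + q * K
  n′ = + s ℤ.+ + q ℤ.* (+ s ℤ.+ + d)
  squares = s * (suc q * suc q) + d * (q * q)
  sizes = s * suc q + d * q
  double : ∀ K → 2 * suc K ≡ 2 + 2 * K
  double = solve-∀
  swap-factors : ∀ m K → m * (2 * K) ≡ K * (2 * m)
  swap-factors = solve-∀
  2m≤ : + (2 * m) ℤ.≤ (+ squares) ℤ.- (+ sizes)
  2m≤ = ℤ.≤-trans (ℤ.≤-reflexive (cancel (+ (2 * m)) (+ sizes))) (ℤ.+-monoˡ-≤ (ℤ.- (+ sizes)) (ℤ.+≤+ le))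
    where
    cancel : ∀ x y → x ≡ (x ℤ.+ y) ℤ.- y
    cancel = ℤ-Solver.solve-∀
  -- Casts of sums agree by computation, so only products need `ℤ.pos-*`.
  squares≡ : + squares ≡ + s ℤ.* ((+ 1 ℤ.+ + q) ℤ.* (+ 1 ℤ.+ + q)) ℤ.+ + d ℤ.* (+ q ℤ.* + q)
  squares≡ = cong₂ ℤ._+_
    (trans (ℤ.pos-* s _) (cong ((+ s) ℤ.*_) (ℤ.pos-* (suc q) (suc q))))
    (trans (ℤ.pos-* d _) (cong ((+ d) ℤ.*_) (ℤ.pos-* q q)))
  sizes≡ : + sizes ≡ + s ℤ.* (+ 1 ℤ.+ + q) ℤ.+ + d ℤ.* + q
  sizes≡ = cong₂ ℤ._+_ (ℤ.pos-* s (suc q)) (ℤ.pos-* d q)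
  n≡ : + n ≡ n′
  n≡ = cong (ℤ._+_ (+ s)) (ℤ.pos-* q K)
  -- With K = s + d, both sides equal qK(qK + s - d).
  expand : ∀ s d q →
    (s ℤ.+ d) ℤ.* ((s ℤ.* ((+ 1 ℤ.+ q) ℤ.* (+ 1 ℤ.+ q)) ℤ.+ d ℤ.* (q ℤ.* q))
      ℤ.- (s ℤ.* (+ 1 ℤ.+ q) ℤ.+ d ℤ.* q)) ≡
    ((s ℤ.+ q ℤ.* (s ℤ.+ d)) ℤ.- s) ℤ.*
      ((s ℤ.+ q ℤ.* (s ℤ.+ d)) ℤ.+ s ℤ.- (+ 1 ℤ.+ (s ℤ.+ d)) ℤ.+ + 1)
  expand = ℤ-Solver.solve-∀

mainTheorem3 : ∀ {a ℓ p : Level} (U : Set a) (_≼_ : Rel U ℓ) → IsTotalOrder _≡_ _≼_ →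
    (k : ℕ) (1<k : 1 < k) (𝒫 : Pattern U p) → IsKPattern k 𝒫 →
    AtMostOneReconstruction _≼_ k 𝒫 →
    (n : ℕ) → 0 < n →
    let r = _%_ n (k ∸ 1) {{k∸1-nonZero 1<k}} in
    (Sₙ : ℕ) → MaxCount 𝒫 n Sₙ →
    ((+ Sₙ) ℚ./ 1) ℚ.≤
    ℚ._/_ (((+ n) ℤ.- (+ r)) ℤ.* ((+ n) ℤ.+ (+ r) ℤ.- (+ k) ℤ.+ (+ 1))) (2 * k ∸ 2) {{2k∸2-nonZero 1<k}}
mainTheorem3 U _≼_ isTotalOrder (suc K) 1<k 𝒫 𝒫-k unique n _ Sₙ ((V , ∣V∣≡n , count) , _) =
  /1-≤-/ Sₙ _ (2 * suc K ∸ 2) {{2k∸2-nonZero 1<k}} (subst₂ Scaled r+d≡K (sym n≡)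
    (bound-scaled r d q Sₙ
      (SubsetCount-≤ isTotalOrder {𝒫 = 𝒫} 𝒫-k unique r d q r+d≡K V (trans ∣V∣≡n n≡sizes) count)))
  where
  instance
    K≢0 : NonZero K
    K≢0 = k∸1-nonZero 1<k
  r = n % K
  q = n / K
  d = K ∸ r
  -- Here `r` remains the remainder of the outer `n` and `K`, so the substitution for the two
  -- parameters leaves it alone.
  Scaled : ℕ → ℕ → Set
  Scaled K n = (+ Sₙ) ℤ.* (+ (2 * suc K ∸ 2)) ℤ.≤
    ((+ n) ℤ.- (+ r)) ℤ.* ((+ n) ℤ.+ (+ r) ℤ.- (+ suc K) ℤ.+ (+ 1))
  r+d≡K : r + d ≡ K
  r+d≡K = m+[n∸m]≡n (<⇒≤ (m%n<n n K))
  n≡ : n ≡ r + q * (r + d)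
  n≡ = trans (m≡m%n+[m/n]*n n K) (cong (λ t → r + q * t) (sym r+d≡K))
  n≡sizes : n ≡ r * suc q + d * q
  n≡sizes = trans n≡ (regroup r d q)
    where
    regroup : ∀ r d q → r + q * (r + d) ≡ r * suc q + d * q
    regroup = solve-∀
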